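{- AC is a decision procedure for $\mathrm{CSP}_{\overline{SP}}(\mathrm{LX})$.
   Context: Patterns. An (unordered) pattern is a tuple $\langle X,D,A,\mathrm{cpt}\rangle$ where $X$ is a finite set of variables; $D$ is a finite set of values; $A\subseteq X\times D$ is the set of points, with $D(x)=\{a\in D\mid \langle x,a\rangle\in A\}$ non-empty for every $x\in X$; $\mathrm{cpt}$ is a partial function from the set of unordered pairs of points $\{\langle x,a\rangle,\langle y,b\rangle\}$ with $x\neq y$ to $\{\mathrm{TRUE},\mathrm{FALSE}\}$. Pairs of points with $\mathrm{cpt}=\mathrm{TRUE}$ (FALSE) are called positive (negative) edges. Instances. A (binary CSP) instance is a pattern $\langle X,D,A,\mathrm{cpt}\rangle$ with $\mathrm{cpt}$ total on all unordered pairs of points belonging to distinct variables. $R_{x,y}=\{\langle a,b\rangle\in D(x)\times D(y)\mid \mathrm{cpt}(\langle x,a\rangle,\langle y,b\rangle)=\mathrm{TRUE}\}$. A solution is a map $s:X\to D$ with $s(x)\in D(x)$ and $\langle s(x),s(y)\rangle\in R_{x,y}$ for all $x\neq y$. Occurrence. An unordered pattern $P'=\langle X',D',A',\mathrm{cpt}'\rangle$ occurs in an instance $I=\langle X,D,A,\mathrm{cpt}\rangle$ if there is a homomorphism from $P'$ to $I$, i.e. a (not necessarily injective) map $f:A'\to A$ such that: if $\mathrm{cpt}'(p,q)$ is defined then $\mathrm{cpt}(f(p),f(q))=\mathrm{cpt}'(p,q)$; and the map $f_{var}:X'\to X$ given by $f_{var}(x')=x$ if $f(\langle x',a'\rangle)=\langle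 x,a\rangle$ for some $a',a$ is well-defined and injective. $\mathrm{CSP}_{\overline{SP}}(P')$ is the set of instances in which $P'$ does not occur. Arc consistency. A point $\langle x,a\rangle$ of an instance is arc consistent if for every variable $y\neq x$ there is a point $\langle y,b\rangle$ compatible with it ($\mathrm{cpt}=\mathrm{TRUE}$). Establishing arc consistency means repeatedly removing points that are not arc consistent. AC is a decision procedure for a class of instances if for every instance of the class, non-emptiness of all domains after establishing arc consistency guarantees that the instance has a solution. The pattern $\mathrm{LX}$: variables $x,y,z$ with pairwise disjoint domains $D(x)=\{\epsilon\}$, $D(y)=\{\alpha,\beta\}$, $D(z)=\{\gamma,\delta\}$ (each value stands for its point); negative edges $\beta\epsilon$, $\delta\epsilon$; positive edges $\alpha\epsilon$, $\gamma\epsilon$, $\alpha\delta$, $\beta\gamma$; no other pair of points has defined compatibility; no variable order and no domain order. -}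

module Defs where

open import Data.Bool using (Bool; true; false)
import Data.Bool.Properties as Bool
open import Data.Fin using (Fin)
open import Data.Fin.Patterns using (0F; 1F; 2F; 3F; 4F)
open import Data.Fin.Properties using (all?; _≟_)
open import Data.Fin.Subset using (Subset; _∈_; _-_; ⁅_⁆; _∪_; Nonempty)
open import Data.Fin.Subset.Properties using (_∈?_; nonempty?)
open import Data.Maybe using (Maybe; just; nothing; Is-just)
import Data.Maybe.Properties as Maybe
open import Data.Maybe.Relation.Unary.Any using () renaming (dec to any-dec)
open import Data.Nat using (ℕ)
open import Data.Product using (Σ; ∃-syntax; _×_; _,_; proj₁; proj₂)
open import Data.Unit using (tt)
open import Data.Vec.Functional using (updateAt)
open import Function.Definitions using (Injective)
open import Relation.Binary.Construct.Closure.ReflexiveTransitive using (Star)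
open import Relation.Binary.PropositionalEquality using (_≡_; _≢_)
open import Relation.Nullary using (¬_; yes)
open import Relation.Nullary.Decidable using (from-yes; _×-dec_; _→-dec_; ¬?)
open import Relation.Unary using (Pred)
open import Level using (0ℓ)

-- The finite sets X and D are taken to be Fin n and Fin d.  The point set
-- A ⊆ X × D is given by its sections dom x = D(x).
--
-- The partial function cpt on unordered pairs of points is encoded as a
-- symmetric Maybe-valued function on X × D, which by cpt-support is
-- undefined (nothing) except at pairs of points with distinct variables.
record Pattern : Set where
  field
    n d : ℕ

  X : Set
  X = Fin n

  D : Set
  D = Fin d

  field
    dom          : X → Subset d
    dom-nonempty : ∀ x → Nonempty (dom x)

  A : Pred (X × D) 0ℓ
  A (x , a) = a ∈ dom x

  field
    cpt         : X × D → X × D → Maybe Bool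
    cpt-sym     : ∀ p q → cpt p q ≡ cpt q p
    cpt-support : ∀ p q → Is-just (cpt p q) → A p × A q × proj₁ p ≢ proj₁ q

  Point : Set
  Point = Σ (X × D) A

  var : Point → X
  var ((x , _) , _) = x

record Instance : Set where
  field
    underlying : Pattern

  open Pattern underlying public

  field
    cpt-total : ∀ p q → A p → A q → proj₁ p ≢ proj₁ q → Is-just (cpt p q)

  R : X → X → Pred (D × D) 0ℓ
  R x y (a , b) = a ∈ dom x × b ∈ dom y × cpt (x , a) (y , b) ≡ just true

record Solution (I : Instance) : Set where
  open Instance I
  field
    s     : X → D
    s∈dom : ∀ x → s x ∈ dom x
    s∈R   : ∀ x y → x ≢ y → R x y (s x , s y)

-- The field f-var together with f-var-correct says that the induced map on
-- variables is well-defined; it is unique because no domain is empty.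
record Homomorphism (P : Pattern) (I : Instance) : Set where
  private
    module P = Pattern P
    module I = Instance I
  field
    f               : P.Point → I.Point
    f-cpt           : ∀ p q t → P.cpt (proj₁ p) (proj₁ q) ≡ just t →
                      I.cpt (proj₁ (f p)) (proj₁ (f q)) ≡ just t
    f-var           : P.X → I.X
    f-var-correct   : ∀ p → I.var (f p) ≡ f-var (P.var p)
    f-var-injective : Injective _≡_ _≡_ f-var

_OccursIn_ : Pattern → Instance → Set
P OccursIn I = Homomorphism P I

CSP-SP : Pattern → Pred Instance 0ℓ
CSP-SP P I = ¬ (P OccursIn I)

-- Removing points can empty a domain, so the intermediate stages are
-- families of current domains rather than instances.
module ArcConsistency (I : Instance) where
  open Instance I

  Domains : Set
  Domains = X → Subset d

  ArcConsistent : Domains → Pred (X × D) 0ℓ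
  ArcConsistent E (x , a) =
    ∀ y → y ≢ x → ∃[ b ] (b ∈ E y × cpt (x , a) (y , b) ≡ just true)

  data _⟶_ (E : Domains) : Domains → Set where
    remove : ∀ x a → a ∈ E x → ¬ ArcConsistent E (x , a) →
             E ⟶ updateAt E x (_- a)

  -- E is an outcome of establishing arc consistency: it is reached from the
  -- original domains by successive removals, and nothing is left to remove.
  Established : Pred Domains 0ℓ
  Established E =
    Star _⟶_ dom E × (∀ x a → a ∈ E x → ArcConsistent E (x , a))

ACIsDecisionProcedureFor : Pred Instance 0ℓ → Set
ACIsDecisionProcedureFor C =
  ∀ (I : Instance) → C I →
  let open Instance I
      open ArcConsistency I
  in ∀ (E : Domains) → Established E → (∀ x → Nonempty (E x)) → Solution I

-- Variables x, y, z are 0, 1, 2; values ε, α, β, γ, δ are 0, …, 4.  The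
-- synonyms below denote the points carrying these values.
module LX-Points where
  pattern ε = 0F , 0F
  pattern α = 1F , 1F
  pattern β = 1F , 2F
  pattern γ = 2F , 3F
  pattern δ = 2F , 4F

module LX-Data where
  open LX-Points

  dom : Fin 3 → Subset 5
  dom 0F = ⁅ 0F ⁆
  dom 1F = ⁅ 1F ⁆ ∪ ⁅ 2F ⁆
  dom 2F = ⁅ 3F ⁆ ∪ ⁅ 4F ⁆

  cpt : Fin 3 × Fin 5 → Fin 3 × Fin 5 → Maybe Bool
  cpt β ε = just false
  cpt ε β = just false
  cpt δ ε = just false
  cpt ε δ = just false
  cpt α ε = just true
  cpt ε α = just true
  cpt γ ε = just true
  cpt ε γ = just true
  cpt α δ = just true
  cpt δ α = just true
  cpt β γ = just true
  cpt γ β = just true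
  cpt _ _ = nothing

  dom-nonempty : ∀ x → Nonempty (dom x)
  dom-nonempty = from-yes (all? λ x → nonempty? (dom x))

  cpt-sym : ∀ p q → cpt p q ≡ cpt q p
  cpt-sym (x , a) (y , b) = check x a y b
    where
    check : ∀ x a y b → cpt (x , a) (y , b) ≡ cpt (y , b) (x , a)
    check = from-yes (all? λ x → all? λ a → all? λ y → all? λ b →
      Maybe.≡-dec Bool._≟_ (cpt (x , a) (y , b)) (cpt (y , b) (x , a)))

  cpt-support : ∀ p q → Is-just (cpt p q) →
                proj₂ p ∈ dom (proj₁ p) × proj₂ q ∈ dom (proj₁ q) ×
                proj₁ p ≢ proj₁ q
  cpt-support (x , a) (y , b) = check x a y b
    where
    check : ∀ x a y b → Is-just (cpt (x , a) (y , b)) →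
            a ∈ dom x × b ∈ dom y × x ≢ y
    check = from-yes (all? λ x → all? λ a → all? λ y → all? λ b →
      any-dec (λ _ → yes tt) (cpt (x , a) (y , b)) →-dec
      ((a ∈? dom x) ×-dec (b ∈? dom y) ×-dec ¬? (x ≟ y)))

LX : Pattern
LX = record { n = 3 ; d = 5 ; LX-Data }

{-# OPTIONS --safe #-}

-- In an arc consistent instance without LX, every point (x , a) lies on a
-- solution, by induction on the set of variables.  For variables y, z ≠ x write
-- y ⇒ z if no value of y compatible with (x , a) is compatible with a value of z
-- incompatible with (x , a).  Since LX does not occur, y ⇒ z or z ⇒ y always
-- holds, so some variable r reaches all others along ⇒.  By arc consistency r
-- has a value compatible with (x , a), and by induction the variables other than
-- x have a solution through that value.  Compatibility with (x , a) propagates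
-- along ⇒ from r to all values of this solution, so s(x) = a extends it.
module Submission where

open import Defs

open import Data.Bool using (true; false)
import Data.Bool.Properties as Bool
open import Data.Fin using (suc)
open import Data.Fin.Patterns using (0F; 1F; 2F; 3F; 4F)
open import Data.Fin.Properties using (any?; _≟_)
open import Data.Fin.Subset using (_∈_; _⊆_; ⁅_⁆; Nonempty)
open import Data.Fin.Subset.Properties using (⊆-refl; p─q⊆p; ∉⊥)
open import Data.List using (List; []; _∷_; filter; length; allFin)
open import Data.List.Membership.Propositional using (lose) renaming (_∈_ to _∈ₗ_)
open import Data.List.Membership.Propositional.Properties
  using (∈-filter⁺; ∈-filter⁻; ∈-allFin)
open import Data.List.Properties using (filter-notAll)
open import Data.List.Relation.Unary.Any using (here; there)
open import Data.Maybe using (just; Is-just)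
import Data.Maybe.Properties as Maybe
open import Data.Maybe.Relation.Unary.Any using () renaming (just to is-just)
open import Data.Nat using (_<_)
open import Data.Nat.Induction using (<-wellFounded)
open import Data.Product using (∃-syntax; _×_; _,_; proj₁; proj₂)
open import Data.Sum using (_⊎_; inj₁; inj₂)
open import Data.Unit using (tt)
open import Data.Vec using (here; there)
open import Data.Vec.Functional using (updateAt)
open import Data.Vec.Functional.Properties using (updateAt-updates; updateAt-minimal)
open import Function using (const; _∘_)
open import Induction.WellFounded using (Acc; acc)
open import Level using (0ℓ)
open import Relation.Binary using (Rel; Total)
open import Relation.Binary.Construct.Closure.ReflexiveTransitive using (ε; _◅_; Star)
open import Relation.Binary.PropositionalEquality
  using (_≡_; _≢_; refl; sym; trans; subst)
open import Relation.Nullary using (¬_; Dec; yes; no; contradiction)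
open import Relation.Nullary.Decidable using (_×-dec_; ¬?)
open import Relation.Unary using (Pred)

-- A root from which every element of the list is reachable inside the list;
-- reachability is phrased as an induction principle.
total⇒root : ∀ {A : Set} {_⇒_ : Rel A 0ℓ} → Total _⇒_ → ∀ x xs →
  ∃[ r ] (r ∈ₗ x ∷ xs × ((P : Pred A 0ℓ) →
    (∀ {u v} → u ∈ₗ x ∷ xs → v ∈ₗ x ∷ xs → u ⇒ v → P u → P v) →
    P r → ∀ {v} → v ∈ₗ x ∷ xs → P v))
total⇒root total x [] = x , here refl , λ { P closed Px (here refl) → Px }
total⇒root total x (y ∷ ys) with total⇒root total y ys
-- Comparing `x` with the root `r` of the tail settles the root: if `x ⇒ r`, everything is reached
-- from `x` through `r`; otherwise `r` reaches `x` as well.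
... | r , r∈ , reach with total x r
...   | inj₁ x⇒r = x , here refl , λ
        { P closed Px (here refl) → Px
        ; P closed Px (there v∈) →
            reach P (λ u∈ v∈ → closed (there u∈) (there v∈))
              (closed (here refl) (there r∈) x⇒r Px) v∈ }
...   | inj₂ r⇒x = r , there r∈ , λ
        { P closed Pr (here refl) → closed (there r∈) (here refl) r⇒x Pr
        ; P closed Pr (there v∈) →
            reach P (λ u∈ v∈ → closed (there u∈) (there v∈)) Pr v∈ }

module _ (I : Instance) where
  open Instance I
  open ArcConsistency I

  edge-sym : ∀ {p q t} → cpt p q ≡ just t → cpt q p ≡ just t
  edge-sym {p} {q} e = trans (cpt-sym q p) e

  edge-support : ∀ {p q t} → cpt p q ≡ just t → A p × A q × proj₁ p ≢ proj₁ q
  edge-support {p} {q} e = cpt-support p q (subst Is-just (sym e) (is-just tt))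

  -- Occurrences of `LX` from its six edges

  module _ {x y z : X} {e a b c d : D}
           (βε : cpt (y , b) (x , e) ≡ just false)
           (δε : cpt (z , d) (x , e) ≡ just false)
           (αε : cpt (y , a) (x , e) ≡ just true)
           (γε : cpt (z , c) (x , e) ≡ just true)
           (αδ : cpt (y , a) (z , d) ≡ just true)
           (βγ : cpt (y , b) (z , c) ≡ just true) where
    private
      module LX = Pattern LX

      variable′ : LX.X → X
      variable′ 0F = x
      variable′ 1F = y
      variable′ 2F = z

      value : LX.D → D
      value 0F = e
      value 1F = a
      value 2F = b
      value 3F = c
      value 4F = d

      value∈dom : ∀ i j → j ∈ LX.dom i → value j ∈ dom (variable′ i)
      value∈dom 0F 0F _ = proj₁ (proj₂ (edge-support αε))
      value∈dom 1F 1F _ = proj₁ (edge-support αε)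
      value∈dom 1F 2F _ = proj₁ (edge-support βε)
      value∈dom 2F 3F _ = proj₁ (edge-support γε)
      value∈dom 2F 4F _ = proj₁ (edge-support δε)
      value∈dom 0F (suc j) (there j∈) = contradiction j∈ ∉⊥
      value∈dom 1F 3F (there (there (there ())))
      value∈dom 1F 4F (there (there (there (there ()))))
      value∈dom 2F 1F (there ())
      value∈dom 2F 2F (there (there ()))

      image : LX.X × LX.D → X × D
      image (i , j) = variable′ i , value j

      open LX-Points using (α; β; γ; δ) renaming (ε to ε′)

      image-cpt : ∀ p q t → LX.cpt p q ≡ just t → cpt (image p) (image q) ≡ just t
      image-cpt β  ε′ _ refl = βε
      image-cpt ε′ β  _ refl = edge-sym βε
      image-cpt δ  ε′ _ refl = δε
      image-cpt ε′ δ  _ refl = edge-sym δε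
      image-cpt α  ε′ _ refl = αε
      image-cpt ε′ α  _ refl = edge-sym αε
      image-cpt γ  ε′ _ refl = γε
      image-cpt ε′ γ  _ refl = edge-sym γε
      image-cpt α  δ  _ refl = αδ
      image-cpt δ  α  _ refl = edge-sym αδ
      image-cpt β  γ  _ refl = βγ
      image-cpt γ  β  _ refl = edge-sym βγ

      y≢x : y ≢ x
      y≢x = proj₂ (proj₂ (edge-support αε))

      z≢x : z ≢ x
      z≢x = proj₂ (proj₂ (edge-support γε))

      y≢z : y ≢ z
      y≢z = proj₂ (proj₂ (edge-support αδ))

      variable-injective : ∀ i j → variable′ i ≡ variable′ j → i ≡ j
      variable-injective 0F 0F _  = refl
      variable-injective 0F 1F eq = contradiction (sym eq) y≢x
      variable-injective 0F 2F eq = contradiction (sym eq) z≢x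
      variable-injective 1F 0F eq = contradiction eq y≢x
      variable-injective 1F 1F _  = refl
      variable-injective 1F 2F eq = contradiction eq y≢z
      variable-injective 2F 0F eq = contradiction eq z≢x
      variable-injective 2F 1F eq = contradiction (sym eq) y≢z
      variable-injective 2F 2F _  = refl

    -- Every point of `LX` lies on one of the edges, and every two of its variables are joined by
    -- one, so `cpt-support` supplies both the domain memberships and the injectivity on variables.
    LX-occurs : LX OccursIn I
    LX-occurs = record
      { f               = λ { ((i , j) , j∈) → image (i , j) , value∈dom i j j∈ }
      ; f-cpt           = λ p q → image-cpt (proj₁ p) (proj₁ q)
      ; f-var           = variable′
      ; f-var-correct   = λ _ → refl
      ; f-var-injective = λ {i} {j} → variable-injective i j
      }

  -- Domains under removal

  removal-⊆ : ∀ {E F} → E ⟶ F → ∀ y → F y ⊆ E y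
  removal-⊆ {E} (remove x a _ _) y with y ≟ x
  ... | yes refl = λ b∈ → p─q⊆p (E x) ⁅ a ⁆
          (subst (_ ∈_) (updateAt-updates x E) b∈)
  ... | no y≢x   = subst (_ ∈_) (updateAt-minimal y x E y≢x)

  -- Applied with `dom` as the starting family, this makes `cpt-total` available for the values that
  -- survive.
  removals-⊆ : ∀ {E F} → Star _⟶_ E F → ∀ y → F y ⊆ E y
  removals-⊆ ε        y = ⊆-refl
  removals-⊆ (r ◅ rs) y = removal-⊆ r y ∘ removals-⊆ rs y

  module _ (¬LX : CSP-SP LX I)
           (E : Domains) (E⊆dom : ∀ x → E x ⊆ dom x)
           (consistent : ∀ x a → a ∈ E x → ArcConsistent E (x , a))
           (nonempty : ∀ x → Nonempty (E x)) where

    -- Conflicts at a fixed point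

    Compatible Incompatible : X × D → X × D → Set
    Compatible   p q = cpt p q ≡ just true
    Incompatible p q = cpt p q ≡ just false

    compatible? : ∀ {x y a b} → a ∈ E x → b ∈ E y → x ≢ y →
      Compatible (x , a) (y , b) ⊎ Incompatible (x , a) (y , b)
    compatible? {x} {y} {a} {b} a∈ b∈ x≢y
      -- Abstracting the totality proof together with `cpt` makes the case `nothing` empty.
      with cpt (x , a) (y , b)
         | cpt-total (x , a) (y , b) (E⊆dom x a∈) (E⊆dom y b∈) x≢y
    ... | just true  | _ = inj₁ refl
    ... | just false | _ = inj₂ refl

    -- Half of `LX`, with `p` as ε, `(y , a)` as α and `(z , d)` as δ. Its negation is the relation
    -- `y ⇒ z`.
    Conflict : X × D → X → X → Set
    Conflict p y z = ∃[ a ] ∃[ d ]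
      (Compatible (y , a) p × Incompatible (z , d) p × Compatible (y , a) (z , d))

    conflict? : ∀ p y z → Dec (Conflict p y z)
    conflict? p y z = any? λ a → any? λ d →
      (cpt (y , a) p ≟ᵐ just true) ×-dec (cpt (z , d) p ≟ᵐ just false)
        ×-dec (cpt (y , a) (z , d) ≟ᵐ just true)
      where _≟ᵐ_ = Maybe.≡-dec Bool._≟_

    -- Opposite conflicts at `p` are the two halves of `LX` glued at ε: the first gives α and δ, the
    -- second γ and β.
    conflict-asym : ∀ {p y z} → Conflict p y z → ¬ Conflict p z y
    conflict-asym (a , d , αε , δε , αδ) (c , b , γε , βε , γβ) =
      ¬LX (LX-occurs βε δε αε γε αδ (edge-sym γβ))

    -- Deciding one conflict is enough: if it is present, asymmetry excludes the opposite one.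
    ¬conflict-total : ∀ p → Total (λ y z → ¬ Conflict p y z)
    ¬conflict-total p y z with conflict? p y z
    ... | yes conflict = inj₂ (conflict-asym conflict)
    ... | no ¬conflict = inj₁ ¬conflict

    -- Partial solutions and their extension

    Assignment : (X → D) → Set
    Assignment s = ∀ y → s y ∈ E y

    -- A partial solution is kept as a total function, with arbitrary values from `E` off the list,
    -- so that restricting it to a sublist leaves `s` unchanged.
    SolvesOn : List X → (X → D) → Set
    SolvesOn vs s = ∀ {y z} → y ∈ₗ vs → z ∈ₗ vs → y ≢ z →
      Compatible (y , s y) (z , s z)

    infixl 6 _∖_
    _∖_ : List X → X → List X
    vs ∖ x = filter (λ y → ¬? (y ≟ x)) vs

    ∈-∖⁺ : ∀ {vs x y} → y ∈ₗ vs → y ≢ x → y ∈ₗ vs ∖ x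
    ∈-∖⁺ {x = x} = ∈-filter⁺ (λ y → ¬? (y ≟ x))

    ∈-∖⇒≢ : ∀ {vs x y} → y ∈ₗ vs ∖ x → y ≢ x
    ∈-∖⇒≢ {vs} {x} y∈ = proj₂ (∈-filter⁻ (λ y → ¬? (y ≟ x)) {xs = vs} y∈)

    length-∖ : ∀ {vs x} → x ∈ₗ vs → length (vs ∖ x) < length vs
    length-∖ {vs} {x} x∈ =
      filter-notAll (λ y → ¬? (y ≟ x)) vs (lose x∈ (λ x≢x → x≢x refl))

    module _ {vs x a s} (a∈ : a ∈ E x) (assignment : Assignment s)
             (solves : SolvesOn (vs ∖ x) s)
             (compatible : ∀ {z} → z ∈ₗ vs ∖ x → Compatible (x , a) (z , s z)) where

      updateAt-assignment : Assignment (updateAt s x (const a))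
      updateAt-assignment y with y ≟ x
      ... | yes refl = subst (_∈ E x) (sym (updateAt-updates x s)) a∈
      ... | no y≢x   = subst (_∈ E y) (sym (updateAt-minimal y x s y≢x)) (assignment y)

      updateAt-solves : SolvesOn vs (updateAt s x (const a))
      updateAt-solves {y} {z} y∈ z∈ y≢z with y ≟ x | z ≟ x
      ... | yes refl | yes refl = contradiction refl y≢z
      ... | yes refl | no z≢x
        rewrite updateAt-updates x {const a} s | updateAt-minimal z x {const a} s z≢x
        = compatible (∈-∖⁺ z∈ z≢x)
      ... | no y≢x | yes refl
        rewrite updateAt-updates x {const a} s | updateAt-minimal y x {const a} s y≢x
        = edge-sym (compatible (∈-∖⁺ y∈ y≢x))
      ... | no y≢x | no z≢x
        rewrite updateAt-minimal y x {const a} s y≢x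
              | updateAt-minimal z x {const a} s z≢x
        = solves (∈-∖⁺ y∈ y≢x) (∈-∖⁺ z∈ z≢x) y≢z

    -- Were `s z` incompatible with `(x , a)`, the pair `s y`, `s z`, compatible because `s` solves
    -- `ws`, would be a conflict.
    ¬conflict-propagates : ∀ {ws x a s} → a ∈ E x → Assignment s → SolvesOn ws s →
      (∀ {z} → z ∈ₗ ws → z ≢ x) → ∀ {y z} → y ∈ₗ ws → z ∈ₗ ws →
      ¬ Conflict (x , a) y z →
      Compatible (y , s y) (x , a) → Compatible (z , s z) (x , a)
    ¬conflict-propagates {s = s} a∈ assignment solves ≢x {y} {z} y∈ z∈ ¬conflict y~x
      with y ≟ z | compatible? (assignment z) a∈ (≢x z∈)
    ... | yes refl | _        = y~x
    ... | no _     | inj₁ z~x = z~x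
    ... | no y≢z   | inj₂ z≁x =
      contradiction (s y , s z , y~x , z≁x , solves y∈ z∈ y≢z) ¬conflict

    -- Prescribing the value at `x` strengthens the induction, which can then be applied at the root
    -- with the value that arc consistency provides. The recursion is on length because `vs ∖ x` is
    -- not a subterm of `vs`.
    solutionThrough : ∀ vs → Acc _<_ (length vs) → ∀ {x a} → x ∈ₗ vs → a ∈ E x →
      ∃[ s ] (Assignment s × SolvesOn vs s × s x ≡ a)
    solutionThrough vs (acc rec) {x} {a} x∈ a∈ =
      let s , assignment , solves , compatible =
            solutionAround (vs ∖ x) (rec (length-∖ x∈)) (∈-∖⇒≢ {vs})
      in updateAt s x (const a)
       , updateAt-assignment {vs} a∈ assignment solves compatible
       , updateAt-solves a∈ assignment solves compatible
       , updateAt-updates x s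
      where
      solutionAround : ∀ ws → Acc _<_ (length ws) → (∀ {z} → z ∈ₗ ws → z ≢ x) →
        ∃[ s ] (Assignment s × SolvesOn ws s ×
                (∀ {z} → z ∈ₗ ws → Compatible (x , a) (z , s z)))
      solutionAround [] _ _ =
        -- An empty list has no root; default values from the non-empty domains serve.
        proj₁ ∘ nonempty , proj₂ ∘ nonempty , (λ ()) , (λ ())
      solutionAround (w ∷ ws) ac ≢x =
        let r , r∈ , reach = total⇒root (¬conflict-total (x , a)) w ws
            b , b∈ , x~r = consistent x a a∈ r (≢x r∈)
            -- `ac` comes from `rec` at the shortened list, so this call descends. Forcing the value
            -- `b` at `r` gives the starting point for `reach`.
            s , assignment , solves , sr≡b = solutionThrough (w ∷ ws) ac r∈ b∈
        in s , assignment , solves , λ z∈ → edge-sym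
             (reach (λ z → Compatible (z , s z) (x , a))
               (¬conflict-propagates a∈ assignment solves ≢x)
               (subst (λ c → Compatible (r , c) (x , a)) (sym sr≡b) (edge-sym x~r))
               z∈)

    solutionOn : ∀ vs → ∃[ s ] (Assignment s × SolvesOn vs s)
    -- This case covers an instance with no variables, where there is no point to pass a solution
    -- through.
    solutionOn [] = proj₁ ∘ nonempty , proj₂ ∘ nonempty , λ ()
    solutionOn (v ∷ vs) =
      let s , assignment , solves , _ =
            solutionThrough (v ∷ vs) (<-wellFounded _) (here refl) (proj₂ (nonempty v))
      in s , assignment , solves

    solution : Solution I
    solution =
      let s , assignment , solves = solutionOn (allFin n)
          s∈dom = λ y → E⊆dom y (assignment y)
      in record
        { s     = s
        ; s∈dom = s∈dom
        ; s∈R   = λ y z y≢z →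
            s∈dom y , s∈dom z , solves (∈-allFin y) (∈-allFin z) y≢z
        }

theorem3p4 : ACIsDecisionProcedureFor (CSP-SP LX)
theorem3p4 I ¬LX E (removals , consistent) nonempty =
  solution I ¬LX E (removals-⊆ I removals) consistent nonempty
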